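{- The only Lucas numbers that are squares of Fibonacci numbers (with positive indices) are $L_1 = F_1^2 = 1$, $L_1 = F_2^2 = 1$, and $L_3 = F_3^2 = 4$; that is, for positive integers $k, n$, the equation $L_k = F_n^2$ holds if and only if $(k,n) \in \{(1,1),\ (1,2),\ (3,3)\}$.
   Context: $(F_n)_{n\geqslant 0}$ is the Fibonacci sequence: $F_0=0$, $F_1=1$, $F_{n+1}=F_n+F_{n-1}$ for $n \geqslant 1$. $(L_n)_{n\geqslant 0}$ is the Lucas sequence: $L_0=2$, $L_1=1$, $L_{n+1}=L_n+L_{n-1}$ for $n\geqslant 1$. -}

module Defs where

open import Data.Nat using (ℕ; suc; _+_)

fib : ℕ → ℕ
fib 0             = 0
fib 1             = 1
fib (suc (suc n)) = fib (suc n) + fib n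

lucas : ℕ → ℕ
lucas 0             = 2
lucas 1             = 1
lucas (suc (suc n)) = lucas (suc n) + lucas n

{-# OPTIONS --safe #-}
-- Since L_{2n} = 5 F_n² ± 2, a solution gives L_{2n} = 5 L_k ± 2.  For k ≥ 4 the number 5 L_k
-- lies between the consecutive Lucas numbers L_{k+3} and L_{k+4}, at distance more than 2
-- from both, so no such n exists; the cases k ≤ 3 are finite.
module Submission where

open import Data.List using (_∷_; [])
open import Data.List.Membership.Propositional using (_∈_)
open import Data.List.Relation.Unary.Any using (here; there)
open import Data.Nat using (ℕ; zero; suc; _+_; _*_; _≤_; _<_; _>_; _^_; z≤n; s≤s)
open import Data.Nat.Properties
open import Data.Nat.Tactic.RingSolver using (solve-∀)
open import Data.Product using (_×_; _,_)
open import Data.Sum using (_⊎_; inj₁; inj₂)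
open import Function.Bundles using (_⇔_; mk⇔)
open import Relation.Binary.PropositionalEquality
  using (_≡_; refl; sym; trans; cong; cong₂; module ≡-Reasoning)
open import Relation.Nullary using (¬_; contradiction)
open import Defs

lucas>0 : ∀ n → 1 ≤ lucas n
lucas>0 0             = s≤s z≤n
lucas>0 1             = s≤s z≤n
lucas>0 (suc (suc n)) = m≤n⇒m≤n+o (lucas n) (lucas>0 (suc n))

lucas≥2 : ∀ n → 2 ≤ lucas (2 + n)
lucas≥2 n = +-mono-≤ (lucas>0 (suc n)) (lucas>0 n)

-- lucas itself is not monotone at 0, hence the shifts.
lucas-mono-≤ : ∀ {m n} → m ≤ n → lucas (suc m) ≤ lucas (suc n)
lucas-mono-≤ {n = zero}  z≤n = ≤-refl
lucas-mono-≤ {n = suc n} z≤n = m≤n⇒m≤n+o (lucas n) (lucas-mono-≤ {n = n} z≤n)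
lucas-mono-≤ {suc m} {suc n} (s≤s m≤n) with m≤n⇒m<n∨m≡n m≤n
... | inj₂ refl = ≤-refl
... | inj₁ m<n  = m≤n⇒m≤n+o (lucas n) (lucas-mono-≤ m<n)

lucas-cancel-< : ∀ {m n} → lucas (suc m) < lucas (suc n) → m < n
lucas-cancel-< Lm<Ln = ≰⇒> λ n≤m → <⇒≱ Lm<Ln (lucas-mono-≤ n≤m)

-- With f = F_n, g = F_{n+1}, x = L_{2n}, y = L_{2n+1}: the values of x and y in terms of f and g
-- together with Cassini's identity, for n even and for n odd respectively.
EvenRelations OddRelations : (f g x y : ℕ) → Set
EvenRelations f g x y = x ≡ 5 * (f * f) + 2 × y ≡ 5 * (f * g) + 1 × g * g ≡ f * f + f * g + 1
OddRelations  f g x y = x + 2 ≡ 5 * (f * f) × y + 1 ≡ 5 * (f * g) × g * g + 1 ≡ f * f + f * g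

-- The passage from n to n+1: the Fibonacci pair advances by one index and the Lucas pair by two.
-- Cassini's identity has to travel along, since it is what turns f² + fg into g² up to the
-- sign-dependent 1. Here x and y are given outright, so everything reduces to polynomials in f and
-- g.
even⇒odd : ∀ f g x y → EvenRelations f g x y →
           OddRelations g (g + f) (y + x) (y + x + y)
even⇒odd f g x y (refl , refl , cassini) = double , next , cassini′
  where
  open ≡-Reasoning
  double : 5 * (f * g) + 1 + (5 * (f * f) + 2) + 2 ≡ 5 * (g * g)
  double = begin
    5 * (f * g) + 1 + (5 * (f * f) + 2) + 2 ≡⟨ lemma f g ⟩
    5 * (f * f + f * g + 1)                 ≡⟨ cong (5 *_) cassini ⟨
    5 * (g * g)                             ∎
    where
    lemma : ∀ f g → 5 * (f * g) + 1 + (5 * (f * f) + 2) + 2 ≡ 5 * (f * f + f * g + 1)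
    lemma = solve-∀
  next : 5 * (f * g) + 1 + (5 * (f * f) + 2) + (5 * (f * g) + 1) + 1 ≡ 5 * (g * (g + f))
  next = begin
    5 * (f * g) + 1 + (5 * (f * f) + 2) + (5 * (f * g) + 1) + 1 ≡⟨ regroup f g ⟩
    5 * (f * g) + 1 + (5 * (f * f) + 2) + 2 + 5 * (f * g)       ≡⟨ cong (_+ 5 * (f * g)) double ⟩
    5 * (g * g) + 5 * (f * g)                                   ≡⟨ factor f g ⟩
    5 * (g * (g + f))                                           ∎
    where
    regroup : ∀ f g → 5 * (f * g) + 1 + (5 * (f * f) + 2) + (5 * (f * g) + 1) + 1
                    ≡ 5 * (f * g) + 1 + (5 * (f * f) + 2) + 2 + 5 * (f * g)
    regroup = solve-∀
    factor : ∀ f g → 5 * (g * g) + 5 * (f * g) ≡ 5 * (g * (g + f))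
    factor = solve-∀
  cassini′ : (g + f) * (g + f) + 1 ≡ g * g + g * (g + f)
  cassini′ = begin
    (g + f) * (g + f) + 1                   ≡⟨ expand f g ⟩
    g * g + g * f + (f * f + f * g + 1)     ≡⟨ cong (g * g + g * f +_) cassini ⟨
    g * g + g * f + g * g                   ≡⟨ factor f g ⟩
    g * g + g * (g + f)                     ∎
    where
    expand : ∀ f g → (g + f) * (g + f) + 1 ≡ g * g + g * f + (f * f + f * g + 1)
    expand = solve-∀
    factor : ∀ f g → g * g + g * f + g * g ≡ g * g + g * (g + f)
    factor = solve-∀

odd⇒even : ∀ f g x y → OddRelations f g x y →
           EvenRelations g (g + f) (y + x) (y + x + y)
odd⇒even f g x y (ex , ey , cassini) = double , next , cassini′
  where
  open ≡-Reasoning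
  double : y + x ≡ 5 * (g * g) + 2
  -- In the odd case x and y are known only after adding 2 and 1, hence the 3 that is added here and
  -- cancelled afterwards.
  double = +-cancelʳ-≡ 3 (y + x) (5 * (g * g) + 2) (begin
    y + x + 3                 ≡⟨ regroup x y ⟩
    (x + 2) + (y + 1)         ≡⟨ cong₂ _+_ ex ey ⟩
    5 * (f * f) + 5 * (f * g) ≡⟨ *-distribˡ-+ 5 (f * f) (f * g) ⟨
    5 * (f * f + f * g)       ≡⟨ cong (5 *_) cassini ⟨
    5 * (g * g + 1)           ≡⟨ expand g ⟩
    5 * (g * g) + 2 + 3       ∎)
    where
    regroup : ∀ x y → y + x + 3 ≡ (x + 2) + (y + 1)
    regroup = solve-∀
    expand : ∀ g → 5 * (g * g + 1) ≡ 5 * (g * g) + 2 + 3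
    expand = solve-∀
  next : y + x + y ≡ 5 * (g * (g + f)) + 1
  next = begin
    y + x + y                   ≡⟨ cong (_+ y) double ⟩
    5 * (g * g) + 2 + y         ≡⟨ regroup g y ⟩
    5 * (g * g) + 1 + (y + 1)   ≡⟨ cong (5 * (g * g) + 1 +_) ey ⟩
    5 * (g * g) + 1 + 5 * (f * g) ≡⟨ factor f g ⟩
    5 * (g * (g + f)) + 1       ∎
    where
    regroup : ∀ g y → 5 * (g * g) + 2 + y ≡ 5 * (g * g) + 1 + (y + 1)
    regroup = solve-∀
    factor : ∀ f g → 5 * (g * g) + 1 + 5 * (f * g) ≡ 5 * (g * (g + f)) + 1
    factor = solve-∀
  cassini′ : (g + f) * (g + f) ≡ g * g + g * (g + f) + 1
  cassini′ = begin
    (g + f) * (g + f)               ≡⟨ expand f g ⟩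
    g * g + g * f + (f * f + f * g) ≡⟨ cong (g * g + g * f +_) cassini ⟨
    g * g + g * f + (g * g + 1)     ≡⟨ factor f g ⟩
    g * g + g * (g + f) + 1         ∎
    where
    expand : ∀ f g → (g + f) * (g + f) ≡ g * g + g * f + (f * f + f * g)
    expand = solve-∀
    factor : ∀ f g → g * g + g * f + (g * g + 1) ≡ g * g + g * (g + f) + 1
    factor = solve-∀

-- Induction on n, with the two cases alternating. The sum does not record the parity of n, because
-- only bounds valid in both cases are drawn from it.
fib-lucas-relations : ∀ n →
  EvenRelations (fib n) (fib (suc n)) (lucas (n + n)) (lucas (suc (n + n))) ⊎
  OddRelations  (fib n) (fib (suc n)) (lucas (n + n)) (lucas (suc (n + n)))
fib-lucas-relations zero = inj₁ (refl , refl , refl)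
-- The rewrite exposes two successors in the index, so that `lucas` unfolds to the sums produced by
-- the step lemmas.
fib-lucas-relations (suc n) rewrite +-suc n n with fib-lucas-relations n
... | inj₁ r = inj₂ (even⇒odd (fib n) (fib (suc n)) (lucas (n + n)) (lucas (suc (n + n))) r)
... | inj₂ r = inj₁ (odd⇒even (fib n) (fib (suc n)) (lucas (n + n)) (lucas (suc (n + n))) r)

5fib²≤lucas+2 : ∀ n → 5 * (fib n * fib n) ≤ lucas (n + n) + 2
5fib²≤lucas+2 n with fib-lucas-relations n
... | inj₁ (eq , _) = ≤-trans (≤-trans (m≤m+n _ 2) (≤-reflexive (sym eq))) (m≤m+n _ 2)
... | inj₂ (eq , _) = ≤-reflexive (sym eq)

lucas≤5fib²+2 : ∀ n → lucas (n + n) ≤ 5 * (fib n * fib n) + 2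
lucas≤5fib²+2 n with fib-lucas-relations n
... | inj₁ (eq , _) = ≤-reflexive eq
... | inj₂ (eq , _) = ≤-trans (≤-trans (m≤m+n _ 2) (≤-reflexive eq)) (m≤m+n _ 2)

-- Unfolding the recurrence down to two adjacent Lucas numbers leaves a linear identity. The excess
-- `2 * lucas (2 + j)` is the gap above `lucas (7 + j)`.
5lucas-lower : ∀ j → 5 * lucas (4 + j) ≡ lucas (7 + j) + 2 * lucas (2 + j)
5lucas-lower j = lemma (lucas (suc j)) (lucas (2 + j))
  where
  lemma : ∀ b c → let d = c + b; e = d + c; f = e + d; g = f + e; h = g + f in
          5 * e ≡ h + 2 * c
  lemma = solve-∀

5lucas-upper : ∀ j → lucas (8 + j) ≡ 5 * lucas (4 + j) + 3 * lucas (3 + j)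
5lucas-upper j = lemma (lucas (3 + j)) (lucas (4 + j))
  where
  lemma : ∀ d e → let f = e + d; g = f + e; h = g + f; i = h + g in
          i ≡ 5 * e + 3 * d
  lemma = solve-∀

lucas≢fib² : ∀ j n → n > 0 → ¬ lucas (4 + j) ≡ fib n * fib n
lucas≢fib² j n@(suc m) _ eq =
  -- Strict comparison of Lucas numbers passes to their indices: n + n would lie strictly between 7
  -- + j and 8 + j. Writing n as `suc m` makes n + n a successor, as `lucas-cancel-<` requires.
  <⇒≱ (lucas-cancel-< {m + suc m} {7 + j} upper) (lucas-cancel-< {6 + j} {m + suc m} lower)
  where
  open ≤-Reasoning
  lower : lucas (7 + j) < lucas (n + n)
  lower = +-cancelʳ-< 2 (lucas (7 + j)) (lucas (n + n)) (begin-strict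
    -- The gap is at least 2 * 2 = 4, which beats the possible error 2.
    lucas (7 + j) + 2                   <⟨ +-monoʳ-< (lucas (7 + j)) (s≤s (s≤s (s≤s z≤n))) ⟩
    lucas (7 + j) + 2 * 2               ≤⟨ +-monoʳ-≤ (lucas (7 + j)) (*-monoʳ-≤ 2 (lucas≥2 j)) ⟩
    lucas (7 + j) + 2 * lucas (2 + j)   ≡⟨ 5lucas-lower j ⟨
    5 * lucas (4 + j)                   ≡⟨ cong (5 *_) eq ⟩
    5 * (fib n * fib n)                 ≤⟨ 5fib²≤lucas+2 n ⟩
    lucas (n + n) + 2                   ∎)
  upper : lucas (n + n) < lucas (8 + j)
  upper = begin-strict
    lucas (n + n)                         ≤⟨ lucas≤5fib²+2 n ⟩
    5 * (fib n * fib n) + 2               ≡⟨ cong (λ x → 5 * x + 2) eq ⟨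
    -- On this side the factor 3 already beats the error 2, so positivity of `lucas (3 + j)`
    -- suffices.
    5 * lucas (4 + j) + 2                 <⟨ +-monoʳ-< (5 * lucas (4 + j)) (n<1+n 2) ⟩
    5 * lucas (4 + j) + 3 * 1             ≤⟨ +-monoʳ-≤ (5 * lucas (4 + j)) (*-monoʳ-≤ 3 (lucas>0 (3 + j))) ⟩
    5 * lucas (4 + j) + 3 * lucas (3 + j) ≡⟨ 5lucas-upper j ⟨
    lucas (8 + j)                         ∎

fib≥3 : ∀ n → 3 ≤ fib (4 + n)
fib≥3 zero    = ≤-refl
fib≥3 (suc n) = m≤n⇒m≤n+o (fib (3 + n)) (fib≥3 n)

-- From index 4 on, squares of Fibonacci numbers are at least 9, whereas the Lucas numbers with
-- index 1, 2, 3 are 1, 3, 4.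
≤4⇒≢fib² : ∀ {x} n → x ≤ 4 → ¬ x ≡ fib (4 + n) ^ 2
≤4⇒≢fib² n x≤4 refl = <⇒≱ (s≤s (≤-trans x≤4 (m≤m+n 4 4))) (^-monoˡ-≤ 2 (fib≥3 n))

corollary3 : ∀ (k n : ℕ) → k > 0 → n > 0 →
    (lucas k ≡ fib n ^ 2) ⇔ ((k , n) ∈ ((1 , 1) ∷ (1 , 2) ∷ (3 , 3) ∷ []))
corollary3 k n k>0 n>0 = mk⇔ (only k n k>0 n>0) solutions
  where
  only : ∀ k n → k > 0 → n > 0 → lucas k ≡ fib n ^ 2 →
         (k , n) ∈ ((1 , 1) ∷ (1 , 2) ∷ (3 , 3) ∷ [])
  only 1 1 _ _ _ = here refl
  only 1 2 _ _ _ = there (here refl)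
  only 1 3 _ _ ()
  only 2 1 _ _ ()
  only 2 2 _ _ ()
  only 2 3 _ _ ()
  only 3 1 _ _ ()
  only 3 2 _ _ ()
  only 3 3 _ _ _ = there (there (here refl))
  only 1 (suc (suc (suc (suc n)))) _ _ eq = contradiction eq (≤4⇒≢fib² n (m≤m+n 1 3))
  only 2 (suc (suc (suc (suc n)))) _ _ eq = contradiction eq (≤4⇒≢fib² n (m≤m+n 3 1))
  only 3 (suc (suc (suc (suc n)))) _ _ eq = contradiction eq (≤4⇒≢fib² n ≤-refl)
  only (suc (suc (suc (suc j)))) n _ n>0 eq =
    -- The power `fib n ^ 2` unfolds to `fib n * (fib n * 1)`; the trailing 1 is removed.
    contradiction (trans eq (cong (fib n *_) (*-identityʳ (fib n)))) (lucas≢fib² j n n>0)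

  solutions : (k , n) ∈ ((1 , 1) ∷ (1 , 2) ∷ (3 , 3) ∷ []) → lucas k ≡ fib n ^ 2
  solutions (here refl)                 = refl
  solutions (there (here refl))         = refl
  solutions (there (there (here refl))) = refl
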